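{- Let $L$ be a finite set of labels and let $t \in T_L$ be an $L$-tree. Then asymptotically almost all $L$-trees contain $t$ as a subtree, i.e. $$\lim_{n\to\infty} \frac{|\{s \in T_L : |s| = n,\ s \text{ contains } t \text{ as a subtree}\}|}{|\{s \in T_L : |s| = n\}|} = 1 .$$
   Context: For a finite set $L$ of distinct labels, the set $T_L$ of $L$-trees consists of plane binary trees in which every leaf carries a label from $L$; that is, $T_L$ is the smallest set containing every single-leaf tree labelled by an element of $L$ and, with any two trees $t_1,t_2$, the tree with a binary root node, left subtree $t_1$ and right subtree $t_2$. The size $|s|$ of an $L$-tree $s$ is the number of its binary (inner) nodes, so leaves have size $0$. An $L$-tree $s$ contains $t$ as a subtree if $s = t$, or $s$ has a left and a right subtree at its root and at least one of these contains $t$ as a subtree. "Asymptotically almost all" means with asymptotic density $1$. -}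

module Defs where

open import Data.Empty using (⊥)
open import Data.Fin.Base using (Fin)
import Data.Fin.Properties as Fin
open import Data.Integer.Base using (+_)
open import Data.List.Base
  using (List; _∷_; _++_; map; filter; length; allFin; cartesianProductWith)
open import Data.List.Membership.Propositional using (_∈_)
open import Data.List.Membership.Propositional.Properties
  using (∈-map⁺; ∈-map⁻; ∈-++⁺ˡ; ∈-++⁺ʳ; ∈-filter⁺; ∈-filter⁻; ∈-allFin;
         ∈-cartesianProductWith⁺; ∈-cartesianProductWith⁻)
open import Data.List.Relation.Unary.Unique.Propositional using (Unique)
open import Data.List.Relation.Unary.Unique.Propositional.Properties
  using (map⁺; ++⁺; filter⁺; allFin⁺; cartesianProductWith⁺)
open import Data.Nat.Base using (ℕ; zero; suc; _≤_; _≥_; s≤s; NonZero)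
import Data.Nat.Properties as ℕ
open import Data.Product.Base using (_×_; _,_; proj₂; ∃-syntax)
open import Data.Rational.Base as ℚ using (ℚ; 0ℚ; _/_)
open import Data.Sum.Base using (inj₁; inj₂; [_,_]′)
open import Data.Tree.Binary using (Tree; leaf; node; #nodes)
open import Data.Unit.Base using (⊤; tt)
open import Function.Base using (_∘_)
open import Function.Bundles using (_↔_; _⇔_; mk⇔; Equivalence; Inverse)
open import Function.Properties.Inverse using (Inverse⇒Injection)
open import Level using (Level; 0ℓ; _⊔_)
open import Relation.Binary.Definitions using (DecidableEquality)
open import Relation.Binary.PropositionalEquality
  using (_≡_; refl; sym; trans; cong; subst)
open import Relation.Nullary.Decidable using (Dec; no; map′; _×-dec_; _⊎-dec_)
open import Relation.Unary using (Pred; Decidable)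

private
  variable
    a p ℓ : Level
    A : Set a
    L : Set ℓ
    k : ℕ

record FiniteSubset {A : Set a} (P : Pred A p) : Set (a ⊔ p) where
  field
    elements : List A
    unique   : Unique elements
    exact    : ∀ x → x ∈ elements ⇔ P x

open FiniteSubset

card : (P : Pred A p) → FiniteSubset P → ℕ
card P P-finite = length (elements P-finite)

finiteSubset : {P : Pred A p} (xs : List A) → Unique xs → Decidable P →
               (∀ {x} → P x → x ∈ xs) → FiniteSubset P
finiteSubset xs xs! P? P⊆xs = record
  { elements = filter P? xs
  ; unique   = filter⁺ P? xs!
  ; exact    = λ x → mk⇔ (λ x∈ → proj₂ (∈-filter⁻ P? {xs = xs} x∈))
                         (λ px → ∈-filter⁺ P? (P⊆xs px) px)
  }

card-nonZero : {P : Pred A p} (P-finite : FiniteSubset P) (x : A) → P x →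
               NonZero (card P P-finite)
card-nonZero P-finite x px = go (Equivalence.from (exact P-finite x) px)
  where
  go : ∀ {xs} → x ∈ xs → NonZero (length xs)
  go {_ ∷ _} _ = _

-- Inner nodes carry no information; the size of a tree is #nodes.
LTree : Set ℓ → Set ℓ
LTree L = Tree ⊤ L

data _Contains_ {L : Set ℓ} : LTree L → LTree L → Set ℓ where
  root  : ∀ {s t} → s ≡ t → s Contains t
  left  : ∀ {l r t} → l Contains t → node l tt r Contains t
  right : ∀ {l r t} → r Contains t → node l tt r Contains t

OfSize : {L : Set ℓ} → ℕ → Pred (LTree L) 0ℓ
OfSize n s = #nodes s ≡ n

OfSizeContaining : {L : Set ℓ} → ℕ → LTree L → Pred (LTree L) ℓ
OfSizeContaining n t s = OfSize n s × s Contains t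

tree-≟ : DecidableEquality L → DecidableEquality (LTree L)
tree-≟ _≟_ (leaf x) (leaf y) = map′ (cong leaf) (λ { refl → refl }) (x ≟ y)
tree-≟ _≟_ (leaf _) (node _ _ _) = no λ ()
tree-≟ _≟_ (node _ _ _) (leaf _) = no λ ()
tree-≟ _≟_ (node l _ r) (node l′ _ r′) =
  map′ (λ { (refl , refl) → refl }) (λ { refl → refl , refl })
       (tree-≟ _≟_ l l′ ×-dec tree-≟ _≟_ r r′)

contains? : DecidableEquality L → (s t : LTree L) → Dec (s Contains t)
contains? _≟_ (leaf x) t = map′ root (λ { (root eq) → eq }) (tree-≟ _≟_ (leaf x) t)
contains? _≟_ s@(node l _ r) t =
  map′ [ root , [ left , right ]′ ]′
       (λ { (root eq) → inj₁ eq ; (left c) → inj₂ (inj₁ c) ; (right c) → inj₂ (inj₂ c) })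
       (tree-≟ _≟_ s t ⊎-dec (contains? _≟_ l t ⊎-dec contains? _≟_ r t))

someLabel : LTree L → L
someLabel (leaf x)     = x
someLabel (node l _ _) = someLabel l

comb : L → ℕ → LTree L
comb x zero    = leaf x
comb x (suc n) = node (leaf x) tt (comb x n)

#nodes-comb : (x : L) (n : ℕ) → #nodes (comb x n) ≡ n
#nodes-comb x zero    = refl
#nodes-comb x (suc n) = cong suc (#nodes-comb x n)

module _ {L : Set ℓ} (L-finite : L ↔ Fin k) where

  open Inverse L-finite using (to; from; strictlyInverseˡ; strictlyInverseʳ)

  label-≟ : DecidableEquality L
  label-≟ = Fin.inj⇒≟ (Inverse⇒Injection L-finite)

  leaves : List (LTree L)
  leaves = map (leaf ∘ from) (allFin k)

  -- The trees of height at most d.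
  treesUpTo : ℕ → List (LTree L)
  treesUpTo zero    = leaves
  treesUpTo (suc d) =
    leaves ++ cartesianProductWith (λ l r → node l tt r) (treesUpTo d) (treesUpTo d)

  leaves-unique : Unique leaves
  leaves-unique = map⁺ (λ eq → from-injective (leaf-injective eq)) (allFin⁺ k)
    where
    leaf-injective : ∀ {x y : L} → leaf {N = ⊤} x ≡ leaf y → x ≡ y
    leaf-injective refl = refl

    from-injective : ∀ {i j} → from i ≡ from j → i ≡ j
    from-injective {i} {j} eq =
      trans (sym (strictlyInverseˡ i)) (trans (cong to eq) (strictlyInverseˡ j))

  leaf∈leaves : ∀ x → leaf x ∈ leaves
  leaf∈leaves x = subst (λ y → leaf y ∈ leaves) (strictlyInverseʳ x)
                        (∈-map⁺ (leaf ∘ from) (∈-allFin (to x)))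

  treesUpTo-unique : ∀ d → Unique (treesUpTo d)
  treesUpTo-unique zero    = leaves-unique
  treesUpTo-unique (suc d) =
    ++⁺ leaves-unique
        (cartesianProductWith⁺ _ (λ { refl → refl , refl })
           (treesUpTo-unique d) (treesUpTo-unique d))
        (λ (s∈leaves , s∈nodes) → disjoint s∈leaves s∈nodes)
    where
    disjoint : ∀ {s} → s ∈ leaves →
               s ∈ cartesianProductWith (λ l r → node l tt r) (treesUpTo d) (treesUpTo d) → ⊥
    disjoint p q
      with ∈-map⁻ (leaf ∘ from) p
         | ∈-cartesianProductWith⁻ (λ l r → node l tt r) (treesUpTo d) (treesUpTo d) q
    ... | _ , _ , refl | _ , _ , _ , _ , ()

  treesUpTo-complete : ∀ d s → #nodes s ≤ d → s ∈ treesUpTo d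
  treesUpTo-complete zero    (leaf x) _ = leaf∈leaves x
  treesUpTo-complete (suc d) (leaf x) _ = ∈-++⁺ˡ (leaf∈leaves x)
  treesUpTo-complete d (node l _ r) l+1+r≤d
    with d | subst (_≤ d) (ℕ.+-suc (#nodes l) (#nodes r)) l+1+r≤d
  ... | suc d′ | s≤s l+r≤d′ =
    ∈-++⁺ʳ leaves (∈-cartesianProductWith⁺ _
      (treesUpTo-complete d′ l (ℕ.m+n≤o⇒m≤o (#nodes l) l+r≤d′))
      (treesUpTo-complete d′ r (ℕ.m+n≤o⇒n≤o (#nodes l) l+r≤d′)))

  ofSize-finite : ∀ n → FiniteSubset (OfSize {L = L} n)
  ofSize-finite n =
    finiteSubset (treesUpTo n) (treesUpTo-unique n) (λ s → #nodes s ℕ.≟ n)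
      (λ {s} eq → treesUpTo-complete n s (ℕ.≤-reflexive eq))

  ofSizeContaining-finite : ∀ n t → FiniteSubset (OfSizeContaining n t)
  ofSizeContaining-finite n t =
    finiteSubset (treesUpTo n) (treesUpTo-unique n)
      (λ s → (#nodes s ℕ.≟ n) ×-dec contains? label-≟ s t)
      (λ {s} (eq , _) → treesUpTo-complete n s (ℕ.≤-reflexive eq))

  ofSize-nonZero : LTree L → ∀ n → NonZero (card (OfSize n) (ofSize-finite n))
  ofSize-nonZero t n = card-nonZero (ofSize-finite n) (comb x n) (#nodes-comb x n)
    where x = someLabel t

  -- The denominator is non-zero because t shows that L is inhabited.
  proportionContaining : LTree L → ℕ → ℚ
  proportionContaining t n =
    (+ card (OfSizeContaining n t) (ofSizeContaining-finite n t))
      / card (OfSize n) (ofSize-finite n)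
    where instance _ = ofSize-nonZero t n

-- Rational ε suffice: below every positive real there is a positive rational.
_⟶_ : (ℕ → ℚ) → ℚ → Set
f ⟶ q = ∀ ε → 0ℚ ℚ.< ε → ∃[ N ] (∀ n → n ≥ N → ℚ.∣ f n ℚ.- q ∣ ℚ.< ε)

{-# OPTIONS --safe #-}

-- Let m = |t| and k = |L|. Grafting t onto a chosen leaf of a tree s that
-- avoids t creates exactly one occurrence of t, so s and the leaf can be
-- recovered from the result and the label that was erased. Hence, writing T(n)
-- and A(n) for the numbers of all and of t-avoiding trees of size n,
-- (n + 1) A(n) ≤ k T(n + m). Deleting a leaf together with its parent, as in
-- Rémy's algorithm, gives (n + 2) T(n + 1) ≤ 2k (2n + 1) T(n), so that
-- T(n + m) ≤ (4k)^m T(n). Therefore A(n) / T(n) = O(1 / n).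
module Submission where

open import Defs
open import Data.Fin.Base using (Fin)
open import Data.Nat.Base using (ℕ)
open import Data.Rational.Base using (1ℚ)
open import Function.Bundles using (_↔_)

open import Data.Empty using (⊥-elim)
open import Data.Integer.Base as ℤ using (+[1+_]; +<+)
import Data.Integer.Properties as ℤ
import Data.Integer.Tactic.RingSolver as ℤ-Solver
open import Data.List.Base
  using (List; []; _∷_; _++_; _∷ʳ_; [_]; map; filter; length; concatMap; allFin;
         initLast; _∷ʳ′_)
open import Data.List.Membership.Propositional using (_∈_; lose)
open import Data.List.Membership.Propositional.Properties
  using (∈-∃++; ∈-++⁺ˡ; ∈-++⁺ʳ; ∈-++⁻; ∈-map⁺; ∈-map⁻; ∈-filter⁻; ∈-allFin; ∈-concatMap⁺)
open import Data.List.Properties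
  using (length-++; length-map; length-tabulate)
open import Data.List.Relation.Unary.All as All using (All; []; _∷_)
import Data.List.Relation.Unary.All.Properties as All
open import Data.List.Relation.Unary.Any using (here; there)
import Data.List.Relation.Unary.AllPairs as AllPairs
import Data.List.Relation.Unary.AllPairs.Properties as AllPairs
open import Data.List.Relation.Unary.Unique.Propositional using (Unique; []; _∷_)
open import Data.List.Relation.Unary.Unique.Propositional.Properties
  using (map⁺; ++⁺; filter⁺; concat⁺)
open import Data.Nat.Base using (zero; suc; _+_; _*_; _^_; _≤_; _<_; _≥_; z≤n; s≤s; NonZero)
open import Data.Nat.Coprimality using (Coprime)
import Data.Nat.Properties as ℕ
open import Data.Nat.Tactic.RingSolver using (solve-∀)
open import Data.Product.Base using (_×_; _,_; proj₁; proj₂; map₁)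
open import Data.Rational.Base as ℚ using (mkℚ; _/_; *<*; toℚᵘ)
import Data.Rational.Properties as ℚ
open import Data.Rational.Unnormalised.Base as ℚᵘ using (mkℚᵘ; 1ℚᵘ; *≡*; *<*)
import Data.Rational.Unnormalised.Properties as ℚᵘ
open import Data.Sum.Base using (inj₁; inj₂)
open import Data.Tree.Binary using (leaf; node; #nodes)
open import Data.Unit.Base using (tt)
open import Function.Base using (_∘_; id)
open import Function.Bundles using (Equivalence; Inverse)
open import Level using (Level)
open import Relation.Binary.PropositionalEquality
  using (_≡_; refl; sym; trans; cong; cong₂; subst; module ≡-Reasoning)
open import Relation.Nullary.Decidable using (yes; no; ¬?; _×-dec_)
open import Relation.Nullary.Negation using (¬_; contradiction)
open import Relation.Unary using (Pred; Decidable)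

private
  variable
    a b p q ℓ : Level
    A : Set a
    B : Set b
    L : Set ℓ

-- Counting with duplicate-free lists

-- By induction on `xs`: cut `f x` out of `ys`; injectivity keeps the images of the other entries
-- within the remainder. Injectivity is asked on `xs` only, since grafting is injective only where
-- `t` is avoided.
length-≤-injection : ∀ (f : A → B) {xs ys} → Unique xs →
  (∀ {x y} → x ∈ xs → y ∈ xs → f x ≡ f y → x ≡ y) →
  (∀ {x} → x ∈ xs → f x ∈ ys) → length xs ≤ length ys
length-≤-injection f [] inj into = z≤n
length-≤-injection f {x ∷ xs} (x∉xs ∷ xs!) inj into
  with ys , zs , refl ← ∈-∃++ (into (here refl)) = begin
  suc (length xs)             ≤⟨ s≤s (length-≤-injection f xs! inj′ into′) ⟩
  suc (length (ys ++ zs))     ≡⟨ cong suc (length-++ ys) ⟩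
  suc (length ys + length zs) ≡⟨ ℕ.+-suc (length ys) (length zs) ⟨
  length ys + suc (length zs) ≡⟨ length-++ ys ⟨
  length (ys ++ f x ∷ zs)     ∎
  where
  open ℕ.≤-Reasoning
  inj′ : ∀ {y z} → y ∈ xs → z ∈ xs → f y ≡ f z → y ≡ z
  inj′ y∈ z∈ = inj (there y∈) (there z∈)
  into′ : ∀ {y} → y ∈ xs → f y ∈ ys ++ zs
  into′ {y} y∈ with ∈-++⁻ ys (into (there y∈))
  ... | inj₁ fy∈ys         = ∈-++⁺ˡ fy∈ys
  ... | inj₂ (there fy∈zs) = ∈-++⁺ʳ ys fy∈zs
  ... | inj₂ (here fy≡fx)  =
    contradiction (inj (here refl) (there y∈) (sym fy≡fx)) (All.lookup x∉xs y∈)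

length-concatMap : ∀ (f : A → List B) m xs → (∀ {x} → x ∈ xs → length (f x) ≡ m) →
  length (concatMap f xs) ≡ length xs * m
length-concatMap f m []       eq = refl
length-concatMap f m (x ∷ xs) eq = trans (length-++ (f x))
  (cong₂ _+_ (eq (here refl)) (length-concatMap f m xs (eq ∘ there)))

-- The map `g` recovers from an entry the block it lies in, so blocks of distinct elements are
-- disjoint.
concatMap-unique : ∀ (f : A → List B) (g : B → A) {xs} → (∀ x → Unique (f x)) →
  (∀ {x y} → y ∈ f x → g y ≡ x) → Unique xs → Unique (concatMap f xs)
concatMap-unique f g f! g∘f xs! =
  concat⁺ (All.map⁺ (All.tabulate λ {x} _ → f! x))
          (AllPairs.map⁺ (AllPairs.map
            (λ x≢y {_} (z∈fx , z∈fy) → x≢y (trans (sym (g∘f z∈fx)) (g∘f z∈fy))) xs!))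

-- One side nests the filters and the other filters by a conjunction, because avoiding trees are
-- selected among the trees of size `n`, whereas containing trees are selected in one pass from
-- `treesUpTo n`.
length-filter-split : {P : Pred A p} {Q : Pred A q} (P? : Decidable P) (Q? : Decidable Q) →
  ∀ xs → length (filter (¬? ∘ Q?) (filter P? xs)) + length (filter (λ x → P? x ×-dec Q? x) xs)
         ≡ length (filter P? xs)
length-filter-split P? Q? [] = refl
length-filter-split P? Q? (x ∷ xs) with P? x
... | no _ = length-filter-split P? Q? xs
... | yes _ with Q? x
...   | yes _ = trans (ℕ.+-suc _ _) (cong suc (length-filter-split P? Q? xs))
...   | no _  = cong suc (length-filter-split P? Q? xs)

-- Contexts and grafting

-- Trees with a hole, read from the root down to the hole; each frame keeps the
-- sibling of the subtree that is entered.
data Frame (L : Set ℓ) : Set ℓ where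
  inLeft inRight : LTree L → Frame L

Context : Set ℓ → Set ℓ
Context L = List (Frame L)

plugFrame : Frame L → LTree L → LTree L
plugFrame (inLeft r)  s = node s tt r
plugFrame (inRight l) s = node l tt s

plug : Context L → LTree L → LTree L
plug []      s = s
plug (f ∷ c) s = plugFrame f (plug c s)

sibling : Frame L → LTree L
sibling (inLeft r)  = r
sibling (inRight l) = l

contextSize : Context L → ℕ
contextSize []      = 0
contextSize (f ∷ c) = suc (#nodes (sibling f) + contextSize c)

#nodes-plugFrame : ∀ (f : Frame L) s → #nodes (plugFrame f s) ≡ suc (#nodes (sibling f) + #nodes s)
#nodes-plugFrame (inLeft r)  s = trans (ℕ.+-suc _ _) (cong suc (ℕ.+-comm (#nodes s) (#nodes r)))
#nodes-plugFrame (inRight l) s = ℕ.+-suc _ _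

#nodes-plug : ∀ (c : Context L) s → #nodes (plug c s) ≡ contextSize c + #nodes s
#nodes-plug []      s = refl
#nodes-plug (f ∷ c) s = begin
  #nodes (plugFrame f (plug c s))
    ≡⟨ #nodes-plugFrame f (plug c s) ⟩
  suc (#nodes (sibling f) + #nodes (plug c s))
    ≡⟨ cong (λ n → suc (#nodes (sibling f) + n)) (#nodes-plug c s) ⟩
  suc (#nodes (sibling f) + (contextSize c + #nodes s))
    ≡⟨ cong suc (ℕ.+-assoc (#nodes (sibling f)) _ _) ⟨
  suc (#nodes (sibling f) + contextSize c + #nodes s) ∎
  where open ≡-Reasoning

-- Exposes the frame next to the hole, that is, the parent of the pointed vertex, where leaves are
-- inserted and deleted.
plug-∷ʳ : ∀ (c : Context L) f s → plug (c ∷ʳ f) s ≡ plug c (plugFrame f s)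
plug-∷ʳ []      f s = refl
plug-∷ʳ (g ∷ c) f s = cong (plugFrame g) (plug-∷ʳ c f s)

plug-contains : ∀ (c : Context L) t → plug c t Contains t
plug-contains []              t = root refl
plug-contains (inLeft _ ∷ c)  t = left (plug-contains c t)
plug-contains (inRight _ ∷ c) t = right (plug-contains c t)

node-injective : ∀ {l l′ r r′ : LTree L} → node l tt r ≡ node l′ tt r′ → l ≡ l′ × r ≡ r′
node-injective refl = refl , refl

-- If the holes lay on different sides of a node, then t would occur in a sibling
-- along the other context.
plug-injective-avoiding : ∀ {t s s′ : LTree L} c c′ →
  ¬ plug c s Contains t → ¬ plug c′ s′ Contains t →
  plug c t ≡ plug c′ t → c ≡ c′
plug-injective-avoiding []      []       _ _ _ = refl
-- Equal trees have equal sizes, but a non-empty context adds at least one node to `t`.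
plug-injective-avoiding {t = t} [] (f ∷ c) _ _ eq =
  contradiction (trans (cong #nodes eq) (#nodes-plug (f ∷ c) t)) (ℕ.m≢1+n+m (#nodes t))
plug-injective-avoiding {t = t} (f ∷ c) [] _ _ eq =
  contradiction (trans (sym (cong #nodes eq)) (#nodes-plug (f ∷ c) t)) (ℕ.m≢1+n+m (#nodes t))
plug-injective-avoiding (inLeft r ∷ c) (inLeft r′ ∷ c′) av av′ eq with node-injective eq
... | eqˡ , refl = cong (inLeft r ∷_) (plug-injective-avoiding c c′ (av ∘ left) (av′ ∘ left) eqˡ)
plug-injective-avoiding (inRight l ∷ c) (inRight l′ ∷ c′) av av′ eq with node-injective eq
... | refl , eqʳ = cong (inRight l ∷_) (plug-injective-avoiding c c′ (av ∘ right) (av′ ∘ right) eqʳ)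
plug-injective-avoiding {t = t} (inLeft _ ∷ c) (inRight _ ∷ c′) av av′ refl =
  ⊥-elim (av′ (left (plug-contains c t)))
plug-injective-avoiding {t = t} (inRight _ ∷ c) (inLeft _ ∷ c′) av av′ refl =
  ⊥-elim (av′ (right (plug-contains c t)))

-- Pointing at leaves and at subtrees

-- A leaf is encoded by the context around it and its label, so that `plugLeaf` gives back the whole
-- tree.
leafPointings : LTree L → List (Context L × L)
leafPointings (leaf x)     = [ [] , x ]
leafPointings (node l _ r) = map (map₁ (inLeft r ∷_)) (leafPointings l)
                          ++ map (map₁ (inRight l ∷_)) (leafPointings r)

length-leafPointings : ∀ (s : LTree L) → length (leafPointings s) ≡ suc (#nodes s)
length-leafPointings (leaf x)     = refl
length-leafPointings (node l _ r) = trans (length-++ (map _ (leafPointings l)))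
  (cong₂ _+_ (trans (length-map _ (leafPointings l)) (length-leafPointings l))
             (trans (length-map _ (leafPointings r)) (length-leafPointings r)))

plugLeaf : Context L × L → LTree L
plugLeaf (c , x) = plug c (leaf x)

leafPointings-sound : ∀ (s : LTree L) {cx} → cx ∈ leafPointings s → plugLeaf cx ≡ s
leafPointings-sound (leaf x) (here refl) = refl
leafPointings-sound (node l _ r) cx∈ with ∈-++⁻ (map (map₁ (inLeft r ∷_)) (leafPointings l)) cx∈
... | inj₁ ∈l with _ , ∈l′ , refl ← ∈-map⁻ _ ∈l = cong (λ s → node s tt r) (leafPointings-sound l ∈l′)
... | inj₂ ∈r with _ , ∈r′ , refl ← ∈-map⁻ _ ∈r = cong (node l tt) (leafPointings-sound r ∈r′)

leafPointings-unique : ∀ (s : LTree L) → Unique (leafPointings s)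
leafPointings-unique (leaf x)     = [] ∷ []
leafPointings-unique (node l _ r) =
  ++⁺ (map⁺ (λ { refl → refl }) (leafPointings-unique l))
      (map⁺ (λ { refl → refl }) (leafPointings-unique r))
      disjoint
  where
  disjoint : ∀ {cx} → ¬ (cx ∈ map (map₁ (inLeft r ∷_)) (leafPointings l) ×
                         cx ∈ map (map₁ (inRight l ∷_)) (leafPointings r))
  disjoint (∈l , ∈r) with ∈-map⁻ _ ∈l | ∈-map⁻ _ ∈r
  ... | _ , _ , refl | _ , _ , ()

-- One entry per vertex, leaves included: these are the places where Rémy's algorithm can insert a
-- new leaf.
subtreePointings : LTree L → List (Context L × LTree L)
subtreePointings s@(leaf x)     = [ [] , s ]
subtreePointings s@(node l _ r) = ([] , s) ∷ map (map₁ (inLeft r ∷_)) (subtreePointings l)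
                                          ++ map (map₁ (inRight l ∷_)) (subtreePointings r)

length-subtreePointings : ∀ (s : LTree L) → length (subtreePointings s) ≡ suc (2 * #nodes s)
length-subtreePointings (leaf x)     = refl
length-subtreePointings (node l _ r) = cong suc (begin
  length (map (map₁ (inLeft r ∷_)) (subtreePointings l)
       ++ map (map₁ (inRight l ∷_)) (subtreePointings r))
    ≡⟨ length-++ (map _ (subtreePointings l)) ⟩
  length (map (map₁ (inLeft r ∷_)) (subtreePointings l))
       + length (map (map₁ (inRight l ∷_)) (subtreePointings r))
    ≡⟨ cong₂ _+_ (trans (length-map _ (subtreePointings l)) (length-subtreePointings l))
                 (trans (length-map _ (subtreePointings r)) (length-subtreePointings r)) ⟩
  suc (2 * #nodes l) + suc (2 * #nodes r)
    ≡⟨ arith (#nodes l) (#nodes r) ⟩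
  2 * (#nodes l + suc (#nodes r)) ∎)
  where
  open ≡-Reasoning
  arith : ∀ i j → suc (2 * i) + suc (2 * j) ≡ 2 * (i + suc j)
  arith = solve-∀

subtreePointings-complete : ∀ c (s : LTree L) → (c , s) ∈ subtreePointings (plug c s)
subtreePointings-complete [] (leaf _)     = here refl
subtreePointings-complete [] (node _ _ _) = here refl
subtreePointings-complete (inLeft r ∷ c) s =
  there (∈-++⁺ˡ (∈-map⁺ _ (subtreePointings-complete c s)))
subtreePointings-complete (inRight l ∷ c) s =
  there (∈-++⁺ʳ _ (∈-map⁺ _ (subtreePointings-complete c s)))

∈-concatMap : ∀ (f : A → List B) {xs x y} → x ∈ xs → y ∈ f x → y ∈ concatMap f xs
∈-concatMap f x∈ y∈ = ∈-concatMap⁺ f (lose x∈ y∈)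

-- Growth of the number of trees

module _ {ℓ} {L : Set ℓ} {k : ℕ} (L-finite : L ↔ Fin k) where

  open Inverse L-finite using (to; from; strictlyInverseʳ)

  labels : List L
  labels = map from (allFin k)

  length-labels : length labels ≡ k
  length-labels = trans (length-map from (allFin k)) (length-tabulate id)

  ∈-labels : ∀ x → x ∈ labels
  ∈-labels x = subst (_∈ labels) (strictlyInverseʳ x) (∈-map⁺ from (∈-allFin (to x)))

  trees : ℕ → List (LTree L)
  trees n = FiniteSubset.elements (ofSize-finite L-finite n)

  trees-unique : ∀ n → Unique (trees n)
  trees-unique n = FiniteSubset.unique (ofSize-finite L-finite n)

  ∈-trees⁺ : ∀ {n s} → #nodes s ≡ n → s ∈ trees n
  ∈-trees⁺ {n} {s} = Equivalence.from (FiniteSubset.exact (ofSize-finite L-finite n) s)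

  ∈-trees⁻ : ∀ {n s} → s ∈ trees n → #nodes s ≡ n
  ∈-trees⁻ {n} {s} = Equivalence.to (FiniteSubset.exact (ofSize-finite L-finite n) s)

  #trees : ℕ → ℕ
  #trees n = length (trees n)

  -- Rémy's insertion: `u` gives way to a new node whose children are `u` and a new leaf `x`, in
  -- either order. The result is recorded as pointed at the new leaf, which is where the factor
  -- `k * 2` comes from.
  leafInsertionsAt : Context L × LTree L → List (Context L × L)
  leafInsertionsAt (c , u) = concatMap (λ x → (c ∷ʳ inLeft u , x) ∷ (c ∷ʳ inRight u , x) ∷ []) labels

  leafInsertions : LTree L → List (Context L × L)
  leafInsertions s = concatMap leafInsertionsAt (subtreePointings s)

  length-leafInsertions : ∀ s → length (leafInsertions s) ≡ suc (2 * #nodes s) * (k * 2)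
  length-leafInsertions s =
    trans (length-concatMap leafInsertionsAt (k * 2) (subtreePointings s) λ _ →
             trans (length-concatMap _ 2 labels λ _ → refl) (cong (_* 2) length-labels))
          (cong (_* (k * 2)) (length-subtreePointings s))

  -- Insertion is undone by deleting the pointed leaf and its parent: the leaf's sibling moves up
  -- into the parent's place.
  ∈-leafInsertions : ∀ {n} c x → #nodes (plug c (leaf x)) ≡ suc n →
    (c , x) ∈ concatMap leafInsertions (trees n)
  ∈-leafInsertions {n} c x eq with initLast c
  -- The empty context is ruled out by `eq`, since a single leaf has size `0`. The last frame `f` is
  -- the parent of the leaf.
  ... | c′ ∷ʳ′ f = ∈-concatMap leafInsertions {x = plug c′ u} (∈-trees⁺ size)
    (∈-concatMap leafInsertionsAt (subtreePointings-complete c′ u) (frameCase f))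
    where
    u : LTree L
    u = sibling f
    size : #nodes (plug c′ u) ≡ n
    size = ℕ.suc-injective (begin
      suc (#nodes (plug c′ u))
        ≡⟨ cong suc (#nodes-plug c′ u) ⟩
      suc (contextSize c′ + #nodes u)
        ≡⟨ ℕ.+-suc (contextSize c′) (#nodes u) ⟨
      contextSize c′ + suc (#nodes u)
        ≡⟨ cong (λ n → contextSize c′ + suc n) (ℕ.+-identityʳ (#nodes u)) ⟨
      contextSize c′ + suc (#nodes u + 0)
        ≡⟨ cong (contextSize c′ +_) (#nodes-plugFrame f (leaf x)) ⟨
      contextSize c′ + #nodes (plugFrame f (leaf x))
        ≡⟨ #nodes-plug c′ (plugFrame f (leaf x)) ⟨
      #nodes (plug c′ (plugFrame f (leaf x)))
        ≡⟨ cong #nodes (plug-∷ʳ c′ f (leaf x)) ⟨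
      #nodes (plug (c′ ∷ʳ f) (leaf x))
        ≡⟨ eq ⟩
      suc n ∎)
      where open ≡-Reasoning
    frameCase : ∀ f → (c′ ∷ʳ f , x) ∈ leafInsertionsAt (c′ , sibling f)
    frameCase (inLeft _)  = ∈-concatMap _ (∈-labels x) (here refl)
    frameCase (inRight _) = ∈-concatMap _ (∈-labels x) (there (here refl))

  leafPointed-unique : ∀ {ss : List (LTree L)} → Unique ss → Unique (concatMap leafPointings ss)
  leafPointed-unique = concatMap-unique leafPointings plugLeaf leafPointings-unique
                         (λ {s} → leafPointings-sound s)

  leafPointed-sound : ∀ (ss : List (LTree L)) {cx} → cx ∈ concatMap leafPointings ss → plugLeaf cx ∈ ss
  leafPointed-sound (s ∷ ss) cx∈ with ∈-++⁻ (leafPointings s) cx∈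
  ... | inj₁ ∈s  = here (leafPointings-sound s ∈s)
  ... | inj₂ ∈ss = there (leafPointed-sound ss ∈ss)

  length-leafPointed : ∀ n (ss : List (LTree L)) → (∀ {s} → s ∈ ss → #nodes s ≡ n) →
    length (concatMap leafPointings ss) ≡ length ss * suc n
  length-leafPointed n ss size = length-concatMap leafPointings (suc n) ss
    (λ {s} s∈ → trans (length-leafPointings s) (cong suc (size s∈)))

  -- Leaf-pointed trees of size `suc n` are counted in two ways: by their `2 + n` leaves, and by the
  -- insertions into trees of size `n` that produce them.
  #trees-suc : ∀ n → #trees (suc n) ≤ 4 * k * #trees n
  #trees-suc n = ℕ.*-cancelʳ-≤ _ _ (2 + n) (begin
    #trees (suc n) * (2 + n)
      ≡⟨ length-leafPointed (suc n) (trees (suc n)) ∈-trees⁻ ⟨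
    length (concatMap leafPointings (trees (suc n)))
      ≤⟨ length-≤-injection id (leafPointed-unique (trees-unique (suc n))) (λ _ _ eq → eq)
           (λ {(c , x)} cx∈ → ∈-leafInsertions c x
              (∈-trees⁻ (leafPointed-sound (trees (suc n)) cx∈))) ⟩
    length (concatMap leafInsertions (trees n))
      ≡⟨ length-concatMap leafInsertions _ (trees n) (λ {s} s∈ →
           trans (length-leafInsertions s) (cong (λ n → suc (2 * n) * (k * 2)) (∈-trees⁻ {n} s∈))) ⟩
    #trees n * (suc (2 * n) * (k * 2))
      -- Adding `3` rounds `2 * n + 1` up to `2 * (2 + n)`, so that the factor `2 + n` cancels.
      ≤⟨ ℕ.*-monoʳ-≤ (#trees n) (ℕ.*-monoˡ-≤ (k * 2) (ℕ.m≤m+n (suc (2 * n)) 3)) ⟩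
    #trees n * ((suc (2 * n) + 3) * (k * 2))
      ≡⟨ arith (#trees n) n k ⟩
    4 * k * #trees n * (2 + n) ∎)
    where
    open ℕ.≤-Reasoning
    arith : ∀ t n k → t * ((suc (2 * n) + 3) * (k * 2)) ≡ 4 * k * t * (2 + n)
    arith = solve-∀

  #trees-+ : ∀ m n → #trees (m + n) ≤ (4 * k) ^ m * #trees n
  #trees-+ zero    n = ℕ.≤-reflexive (sym (ℕ.*-identityˡ _))
  #trees-+ (suc m) n = begin
    #trees (suc (m + n))             ≤⟨ #trees-suc (m + n) ⟩
    4 * k * #trees (m + n)           ≤⟨ ℕ.*-monoʳ-≤ (4 * k) (#trees-+ m n) ⟩
    4 * k * ((4 * k) ^ m * #trees n) ≡⟨ ℕ.*-assoc (4 * k) ((4 * k) ^ m) (#trees n) ⟨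
    (4 * k) ^ suc m * #trees n       ∎
    where open ℕ.≤-Reasoning

  -- Trees that avoid `t` are rare

  module _ (t : LTree L) where

    avoids? : Decidable (λ s → ¬ s Contains t)
    avoids? s = ¬? (contains? (label-≟ L-finite) s t)

    avoiders : ℕ → List (LTree L)
    avoiders n = filter avoids? (trees n)

    -- The left side counts avoiding trees pointed at a leaf; grafting `t` onto that leaf maps them
    -- injectively to pairs of a tree and a label.
    avoiders-bound : ∀ n → length (avoiders n) * suc n ≤ #trees (#nodes t + n) * k
    avoiders-bound n = begin
      length (avoiders n) * suc n
        ≡⟨ length-leafPointed n (avoiders n) (∈-trees⁻ ∘ proj₁ ∘ ∈-filter⁻ avoids?) ⟨
      length (concatMap leafPointings (avoiders n))
        ≤⟨ length-≤-injection graft (leafPointed-unique (filter⁺ avoids? (trees-unique n)))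
             graft-injective graft∈ ⟩
      length (concatMap (λ s → map (s ,_) labels) (trees (#nodes t + n)))
        ≡⟨ length-concatMap _ k (trees (#nodes t + n))
             (λ _ → trans (length-map _ labels) length-labels) ⟩
      #trees (#nodes t + n) * k ∎
      where
      open ℕ.≤-Reasoning
      graft : Context L × L → LTree L × L
      -- The label is kept because `plug c t` no longer shows which leaf was overwritten.
      graft (c , x) = plug c t , x

      pointed : ∀ {cx} → cx ∈ concatMap leafPointings (avoiders n) →
                plugLeaf cx ∈ trees n × ¬ plugLeaf cx Contains t
      pointed = ∈-filter⁻ avoids? ∘ leafPointed-sound (avoiders n)

      graft-injective : ∀ {cx dy} → cx ∈ concatMap leafPointings (avoiders n) →
        dy ∈ concatMap leafPointings (avoiders n) → graft cx ≡ graft dy → cx ≡ dy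
      graft-injective {c , x} {d , y} cx∈ dy∈ eq =
        cong₂ _,_ (plug-injective-avoiding c d (proj₂ (pointed cx∈)) (proj₂ (pointed dy∈)) (cong proj₁ eq))
                  (cong proj₂ eq)

      graft∈ : ∀ {cx} → cx ∈ concatMap leafPointings (avoiders n) →
        graft cx ∈ concatMap (λ s → map (s ,_) labels) (trees (#nodes t + n))
      graft∈ {c , x} cx∈ = ∈-concatMap _ (∈-trees⁺ size) (∈-map⁺ _ (∈-labels x))
        where
        size : #nodes (plug c t) ≡ #nodes t + n
        -- A leaf has size `0`, so the context around it has the full size `n` of the avoiding tree.
        size = trans (#nodes-plug c t) (trans (ℕ.+-comm (contextSize c) (#nodes t))
          (cong (#nodes t +_) (trans (sym (ℕ.+-identityʳ (contextSize c)))
            (trans (sym (#nodes-plug c (leaf x))) (∈-trees⁻ (proj₁ (pointed cx∈)))))))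

    avoiders-sparse : ∀ n → length (avoiders n) * suc n ≤ (4 * k) ^ #nodes t * k * #trees n
    avoiders-sparse n = begin
      length (avoiders n) * suc n           ≤⟨ avoiders-bound n ⟩
      #trees (#nodes t + n) * k             ≤⟨ ℕ.*-monoˡ-≤ k (#trees-+ (#nodes t) n) ⟩
      (4 * k) ^ #nodes t * #trees n * k     ≡⟨ arith ((4 * k) ^ #nodes t) (#trees n) k ⟩
      (4 * k) ^ #nodes t * k * #trees n     ∎
      where
      open ℕ.≤-Reasoning
      arith : ∀ x y z → x * y * z ≡ x * z * y
      arith = solve-∀

    avoiders-complement : ∀ n → length (avoiders n)
      + card (OfSizeContaining n t) (ofSizeContaining-finite L-finite n t) ≡ #trees n
    avoiders-complement n = length-filter-split (λ s → #nodes s ℕ.≟ n)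
      (λ s → contains? (label-≟ L-finite) s t) (treesUpTo L-finite n)

-- From counts to the limit

-- Since `b / n - 1 = - a / n`, the claim is `a / n < p / suc d`, which the hypothesis states with
-- denominators cleared.
∣b/n-1∣<ε : ∀ a b n .{{_ : NonZero n}} → a + b ≡ n → ∀ p d .{c : Coprime p (suc d)} →
  a * suc d < p * n →
  ℚ.∣ ℤ.+ b / n ℚ.- 1ℚ ∣ ℚ.< mkℚ (ℤ.+ p) d c
∣b/n-1∣<ε a b (suc n) a+b≡n p d a*d<p*n = ℚ.toℚᵘ-cancel-< (begin-strict
  toℚᵘ ℚ.∣ ℤ.+ b / suc n ℚ.- 1ℚ ∣
    ≃⟨ ℚ.toℚᵘ-homo-∣-∣ (ℤ.+ b / suc n ℚ.- 1ℚ) ⟩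
  ℚᵘ.∣ toℚᵘ (ℤ.+ b / suc n ℚ.- 1ℚ) ∣
    ≃⟨ ℚᵘ.∣-∣-cong (ℚ.toℚᵘ-homo-+ (ℤ.+ b / suc n) (ℚ.- 1ℚ)) ⟩
  ℚᵘ.∣ toℚᵘ (ℤ.+ b / suc n) ℚᵘ.- 1ℚᵘ ∣
    -- Reduction to lowest terms is undone here, so that the denominator is literally `suc n`;
    -- `mkℚᵘ` stores it less one.
    ≃⟨ ℚᵘ.∣-∣-cong (ℚᵘ.+-congˡ (ℚᵘ.- 1ℚᵘ) (ℚ.toℚᵘ-fromℚᵘ (mkℚᵘ (ℤ.+ b) n))) ⟩
  ℚᵘ.∣ mkℚᵘ (ℤ.+ b) n ℚᵘ.- 1ℚᵘ ∣
    ≃⟨ ℚᵘ.∣-∣-cong {mkℚᵘ (ℤ.+ b) n ℚᵘ.- 1ℚᵘ}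
                   {ℚᵘ.- mkℚᵘ (ℤ.+ a) n} (*≡* b-1≡-a) ⟩
  ℚᵘ.∣ ℚᵘ.- mkℚᵘ (ℤ.+ a) n ∣
    ≃⟨ ℚᵘ.∣-p∣≃∣p∣ (mkℚᵘ (ℤ.+ a) n) ⟩
  mkℚᵘ (ℤ.+ a) n
    <⟨ *<* a/n<p/d ⟩
  mkℚᵘ (ℤ.+ p) d ∎)
  where
  open ℚᵘ.≤-Reasoning
  arith : ∀ x y → y ℤ.* ℤ.1ℤ ℤ.+ ℤ.-1ℤ ℤ.* (x ℤ.+ y) ≡ ℤ.- x
  arith = ℤ-Solver.solve-∀
  b-1≡-a : (ℤ.+ b ℤ.* ℤ.1ℤ ℤ.+ ℤ.-1ℤ ℤ.* ℤ.+ suc n) ℤ.* ℤ.+ suc n ≡ (ℤ.- ℤ.+ a) ℤ.* ℤ.+ (suc n * 1)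
  b-1≡-a = cong₂ ℤ._*_
    (trans (cong (λ m → ℤ.+ b ℤ.* ℤ.1ℤ ℤ.+ ℤ.-1ℤ ℤ.* ℤ.+ m) (sym a+b≡n)) (arith (ℤ.+ a) (ℤ.+ b)))
    (cong ℤ.+_ (sym (ℕ.*-identityʳ (suc n))))
  a/n<p/d : ℤ.+ a ℤ.* ℤ.+ suc d ℤ.< ℤ.+ p ℤ.* ℤ.+ suc n
  a/n<p/d rewrite sym (ℤ.pos-* a (suc d)) | sym (ℤ.pos-* p (suc n)) = +<+ a*d<p*n

theorem15 : ∀ {ℓ} {L : Set ℓ} {k : ℕ} (L-finite : L ↔ Fin k) (t : LTree L) →
    proportionContaining L-finite t ⟶ 1ℚ
-- Here `ε` is `suc p / suc d`. The proportion of avoiding trees is at most `K / suc n`, which is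
-- below `1 / suc d`, and hence below `ε`, once `n` reaches `K * suc d`.
theorem15 {k = k} L-finite t (mkℚ +[1+ p ] d _) _ = K * suc d , λ n n≥N →
  ∣b/n-1∣<ε (#avoiders n) _ (#trees L-finite n) {{ofSize-nonZero L-finite t n}}
    (avoiders-complement L-finite t n) (suc p) d (bound n n≥N)
  where
  K : ℕ
  K = (4 * k) ^ #nodes t * k
  #avoiders : ℕ → ℕ
  #avoiders n = length (avoiders L-finite t n)
  bound : ∀ n → n ≥ K * suc d → #avoiders n * suc d < suc p * #trees L-finite n
  -- Both sides are multiplied by `suc n` to make `avoiders-sparse` applicable.
  bound n n≥N = ℕ.*-cancelʳ-< (suc n) _ _ (begin-strict
    #avoiders n * suc d * suc n  ≡⟨ arith (#avoiders n) (suc d) (suc n) ⟩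
    #avoiders n * suc n * suc d  ≤⟨ ℕ.*-monoˡ-≤ (suc d) (avoiders-sparse L-finite t n) ⟩
    K * T * suc d                ≡⟨ arith K T (suc d) ⟩
    -- The strict inequality arises here: `K * suc d < suc n`, and there is at least one tree of
    -- size `n`.
    K * suc d * T                <⟨ ℕ.*-monoˡ-< T {{ofSize-nonZero L-finite t n}} (s≤s n≥N) ⟩
    suc n * T                    ≤⟨ ℕ.*-monoʳ-≤ (suc n) (ℕ.m≤n*m T (suc p)) ⟩
    suc n * (suc p * T)          ≡⟨ ℕ.*-comm (suc n) (suc p * T) ⟩
    suc p * T * suc n            ∎)
    where
    open ℕ.≤-Reasoning
    T = #trees L-finite n
    arith : ∀ x y z → x * y * z ≡ x * z * y
    arith = solve-∀
theorem15 L-finite t (mkℚ (ℤ.+ 0) _ _) (*<* (+<+ ()))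
theorem15 L-finite t (mkℚ ℤ.-[1+ _ ] _ _) (*<* ())
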